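{- Let $n\ge 3$ be an odd integer and $k\ge 3$ an integer. Then the metric dimension of $(C_n\square P_k)\square P_2$ is $3$, i.e. the minimum size of a resolving set of $(C_n\square P_k)\square P_2$ is $3$.
   Context: All graphs are finite and connected; $d(u,v)$ is the shortest-path distance. $C_n$ is the cycle on $n$ vertices and $P_k$ the path on $k$ vertices. The cartesian product $G\square H$ has vertex set $V(G)\times V(H)$, with $(g_1,h_1)$ adjacent to $(g_2,h_2)$ iff either $h_1=h_2$ and $g_1g_2\in E(G)$, or $g_1=g_2$ and $h_1h_2\in E(H)$. For an ordered set $Q=\{q_1,\dots,q_l\}$ of vertices, $r(x|Q)=(d(x,q_1),\dots,d(x,q_l))$. $Q$ is a resolving set of $G$ if any two distinct vertices of $G$ have distinct vectors $r(\cdot|Q)$; the metric dimension $\beta(G)$ is the minimum size of a resolving set. -}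

module Defs where

open import Data.Nat using (ℕ; zero; suc; _+_; _*_; _≤_; z≤n; s≤s)
import Data.Nat.Properties as ℕₚ
open import Data.Fin using (Fin; zero; suc; toℕ)
open import Data.Fin.Properties using (any?; inj⇒≟; *↔×)
open import Data.Product using (∃-syntax; Σ-syntax; _×_; _,_; proj₁; proj₂; map₂)
open import Data.Product.Function.NonDependent.Propositional using (_×-↔_)
open import Data.Sum as Sum using (_⊎_; inj₁; inj₂)
open import Data.Vec using (Vec; map)
open import Data.Vec.Relation.Unary.Unique.Propositional using (Unique)
open import Function using (_∘_)
open import Function.Bundles using (_↔_; Inverse)
open import Function.Construct.Identity using (↔-id)
open import Function.Construct.Composition using (_↔-∘_)
open import Function.Construct.Symmetry using (↔-sym)
open import Function.Properties.Inverse using (↔⇒↣)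
open import Relation.Binary using (Rel; Symmetric; Irreflexive; Decidable; DecidableEquality)
open import Relation.Binary.PropositionalEquality using (_≡_; _≢_; refl; sym; trans; cong; subst)
open import Relation.Nullary using (yes; no; contradiction)
open import Relation.Nullary.Decidable using (map′; _×-dec_; _⊎-dec_)
import Relation.Unary as U
open import Level using (0ℓ)

data Walk {V : Set} (Adj : Rel V 0ℓ) : ℕ → V → V → Set where
  []  : ∀ {u} → Walk Adj 0 u u
  _∷_ : ∀ {m u v w} → Adj u v → Walk Adj m v w → Walk Adj (suc m) u w

-- Finite connected simple graphs. Decidability of adjacency is classically
-- automatic; it is what makes the distance below a computable function.
record Graph : Set₁ where
  field
    Vertex    : Set
    order     : ℕ
    finite    : Vertex ↔ Fin order
    Adj       : Rel Vertex 0ℓ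
    adj?      : Decidable Adj
    adj-sym   : Symmetric Adj
    adj-irr   : Irreflexive _≡_ Adj
    connected : ∀ u v → ∃[ m ] Walk Adj m u v

  _≟ᵛ_ : DecidableEquality Vertex
  _≟ᵛ_ = inj⇒≟ (↔⇒↣ finite)

  walk? : ∀ m → Decidable (Walk Adj m)
  walk? zero u v = map′ (λ { refl → [] }) (λ { [] → refl }) (u ≟ᵛ v)
  walk? (suc m) u w =
    map′ (λ { (i , a , p) → a ∷ p })
         (λ { (_∷_ {v = v} a p) →
              Inverse.to finite v ,
              subst (λ x → Adj u x × Walk Adj m x w)
                    (sym (Inverse.strictlyInverseʳ finite v)) (a , p) })
         (any? λ i → adj? u (Inverse.from finite i)
                     ×-dec walk? m (Inverse.from finite i) w)

least : ∀ {P : ℕ → Set} → U.Decidable P → ∀ n → P n →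
        Σ[ m ∈ ℕ ] P m × (∀ l → P l → m ≤ l)
least P? n pn with P? 0
... | yes p0 = 0 , p0 , λ _ _ → z≤n
least P? zero    pn | no ¬p0 = contradiction pn ¬p0
least P? (suc n) pn | no ¬p0 with least (P? ∘ suc) n pn
... | m , pm , min = suc m , pm , λ
  { zero    p0 → contradiction p0 ¬p0
  ; (suc l) pl → s≤s (min l pl) }

module _ (G : Graph) where
  open Graph G

  shortest : ∀ u v → Σ[ m ∈ ℕ ] Walk Adj m u v × (∀ l → Walk Adj l u v → m ≤ l)
  shortest u v = least (λ m → walk? m u v) (proj₁ (connected u v)) (proj₂ (connected u v))

  -- A shortest walk repeats no vertex, so this is the length of a shortest path.
  dist : Vertex → Vertex → ℕ
  dist u v = proj₁ (shortest u v)

  dist-walk : ∀ u v → Walk Adj (dist u v) u v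
  dist-walk u v = proj₁ (proj₂ (shortest u v))

  dist-minimal : ∀ u v l → Walk Adj l u v → dist u v ≤ l
  dist-minimal u v = proj₂ (proj₂ (shortest u v))

  representation : ∀ {l} → Vertex → Vec Vertex l → Vec ℕ l
  representation x Q = map (dist x) Q

  -- An ordered set of l vertices is a vector of l pairwise distinct vertices.
  ResolvingSet : ∀ {l} → Vec Vertex l → Set
  ResolvingSet Q =
    Unique Q × (∀ x y → x ≢ y → representation x Q ≢ representation y Q)

  HasMetricDimension : ℕ → Set
  HasMetricDimension β =
    (Σ[ Q ∈ Vec Vertex β ] ResolvingSet Q) ×
    (∀ l (Q : Vec Vertex l) → ResolvingSet Q → β ≤ l)

module _ {V : Set} {Adj : Rel V 0ℓ} where

  _++ʷ_ : ∀ {l m u v w} → Walk Adj l u v → Walk Adj m v w → Walk Adj (l + m) u w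
  []      ++ʷ q = q
  (a ∷ p) ++ʷ q = a ∷ (p ++ʷ q)

  reverseʷ : Symmetric Adj → ∀ {m u v} → Walk Adj m u v → ∃[ l ] Walk Adj l v u
  reverseʷ s []      = 0 , []
  reverseʷ s (a ∷ p) = _ , (proj₂ (reverseʷ s p) ++ʷ (s a ∷ []))

mapʷ : ∀ {V W : Set} {A : Rel V 0ℓ} {B : Rel W 0ℓ} (f : V → W) →
       (∀ {u v} → A u v → B (f u) (f v)) →
       ∀ {m u v} → Walk A m u v → Walk B m (f u) (f v)
mapʷ f h []      = []
mapʷ f h (a ∷ p) = h a ∷ mapʷ f h p

PathAdj : ∀ {n} → Rel (Fin n) 0ℓ
PathAdj i j = toℕ j ≡ suc (toℕ i) ⊎ toℕ i ≡ suc (toℕ j)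

pathAdj? : ∀ {n} → Decidable (PathAdj {n})
pathAdj? i j = (toℕ j ℕₚ.≟ suc (toℕ i)) ⊎-dec (toℕ i ℕₚ.≟ suc (toℕ j))

pathAdj-irr : ∀ {n} → Irreflexive _≡_ (PathAdj {n})
pathAdj-irr refl (inj₁ e) = ℕₚ.1+n≢n (sym e)
pathAdj-irr refl (inj₂ e) = ℕₚ.1+n≢n (sym e)

path-from-zero : ∀ {n} (i : Fin (suc n)) → ∃[ m ] Walk PathAdj m zero i
path-from-zero         zero    = 0 , []
path-from-zero {suc n} (suc i) =
  _ , (inj₁ refl ∷ mapʷ suc (Sum.map (cong suc) (cong suc)) (proj₂ (path-from-zero i)))

path-connected : ∀ {n} (i j : Fin n) → ∃[ m ] Walk PathAdj m i j
path-connected {suc n} i j =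
  _ , (proj₂ (reverseʷ Sum.swap (proj₂ (path-from-zero i))) ++ʷ proj₂ (path-from-zero j))

path : ℕ → Graph
path n = record
  { Vertex    = Fin n
  ; order     = n
  ; finite    = ↔-id (Fin n)
  ; Adj       = PathAdj
  ; adj?      = pathAdj?
  ; adj-sym   = Sum.swap
  ; adj-irr   = pathAdj-irr
  ; connected = path-connected
  }

Closes : ∀ {n} → Rel (Fin n) 0ℓ
Closes {n} i j = suc (toℕ i) ≡ n × toℕ j ≡ 0

closes? : ∀ {n} → Decidable (Closes {n})
closes? {n} i j = (suc (toℕ i) ℕₚ.≟ n) ×-dec (toℕ j ℕₚ.≟ 0)

-- Consecutive vertices are adjacent, and so are n - 1 and 0.
CycleAdj : ∀ {n} → Rel (Fin n) 0ℓ
CycleAdj i j = PathAdj i j ⊎ (Closes i j ⊎ Closes j i)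

closes-irr : ∀ {n} → 3 ≤ n → Irreflexive _≡_ (Closes {n})
closes-irr (s≤s (s≤s _)) refl (e , z) with trans (sym (cong suc z)) e
... | ()

cycleAdj-irr : ∀ {n} → 3 ≤ n → Irreflexive _≡_ (CycleAdj {n})
cycleAdj-irr h e (inj₁ p)        = pathAdj-irr e p
cycleAdj-irr h e (inj₂ (inj₁ c)) = closes-irr h e c
cycleAdj-irr h e (inj₂ (inj₂ c)) = closes-irr h (sym e) c

cycle : ∀ n → 3 ≤ n → Graph
cycle n 3≤n = record
  { Vertex    = Fin n
  ; order     = n
  ; finite    = ↔-id (Fin n)
  ; Adj       = CycleAdj
  ; adj?      = λ i j → pathAdj? i j ⊎-dec (closes? i j ⊎-dec closes? j i)
  ; adj-sym   = Sum.map Sum.swap Sum.swap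
  ; adj-irr   = cycleAdj-irr 3≤n
  ; connected = λ i j → map₂ (mapʷ (λ v → v) inj₁) (path-connected i j)
  }

infixl 7 _□_

_□_ : Graph → Graph → Graph
G □ H = record
  { Vertex    = G.Vertex × H.Vertex
  ; order     = G.order * H.order
  ; finite    = ↔-sym *↔× ↔-∘ (G.finite ×-↔ H.finite)
  ; Adj       = BoxAdj
  ; adj?      = λ { (g₁ , h₁) (g₂ , h₂) →
                    ((h₁ H.≟ᵛ h₂) ×-dec G.adj? g₁ g₂) ⊎-dec
                    ((g₁ G.≟ᵛ g₂) ×-dec H.adj? h₁ h₂) }
  ; adj-sym   = Sum.map (λ { (e , a) → sym e , G.adj-sym a })
                        (λ { (e , a) → sym e , H.adj-sym a })
  ; adj-irr   = λ { refl (inj₁ (_ , a)) → G.adj-irr refl a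
                  ; refl (inj₂ (_ , a)) → H.adj-irr refl a }
  ; connected = λ { (g₁ , h₁) (g₂ , h₂) →
                    _ , ( mapʷ (_, h₁) (λ a → inj₁ (refl , a)) (proj₂ (G.connected g₁ g₂))
                          ++ʷ mapʷ (g₂ ,_) (λ a → inj₂ (refl , a)) (proj₂ (H.connected h₁ h₂))) }
  }
  where
  module G = Graph G
  module H = Graph H

  BoxAdj : Rel (G.Vertex × H.Vertex) 0ℓ
  BoxAdj (g₁ , h₁) (g₂ , h₂) = (h₁ ≡ h₂ × G.Adj g₁ g₂) ⊎ (g₁ ≡ g₂ × H.Adj h₁ h₂)

{-# OPTIONS --safe #-}

-- Write n = 2h + 1. The landmarks (0,0,0), (0,0,1), (h,0,0) resolve the graph:
-- the first two reveal the layer of P₂ and the sum A + p, the third then reveals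
-- B + p, where p is the position in P_k and A, B are the distances in the cycle
-- to the vertices 0 and h. So A − B is known. As A + B is h on the arc from 0
-- to h and h + 1 on the complementary arc, the parity of A − B tells the arc.
-- Conversely, every vertex has at least four neighbours. Those of a landmark are
-- equidistant from it, and their distances to a second landmark take at most
-- three values, so two landmarks never resolve the graph.
module Submission where

open import Defs
open import Data.Nat using (ℕ; zero; suc; pred; _+_; _*_; _∸_; _⊓_; _≤_; _<_; z≤n; s≤s; s≤s⁻¹; ∣_-_∣)
open import Data.Nat.Divisibility using (_∣_; divides)
open import Data.Nat.Properties
open import Data.Nat.Tactic.RingSolver using (solve-∀)
open import Data.Fin as Fin using (Fin; zero; suc; toℕ; fromℕ; fromℕ<; inject₁; _↑ˡ_)
open import Data.Fin.Properties
  using (toℕ-injective; toℕ-↑ˡ; toℕ-fromℕ; toℕ-fromℕ<; toℕ-inject₁; toℕ<n; fromℕ<-injective; pigeonhole; +↔⊎)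
import Data.Fin.Properties as Finₚ
open import Data.Empty using (⊥-elim)
open import Data.Product using (∃-syntax; ∃₂; Σ-syntax; _×_; _,_; proj₁; proj₂)
open import Data.Sum as Sum using (_⊎_; inj₁; inj₂)
open import Data.Vec using (Vec; []; _∷_)
open import Data.Vec.Properties using (∷-injective)
open import Data.Vec.Relation.Unary.All using ([]; _∷_)
open import Data.Vec.Relation.Unary.AllPairs using ([]; _∷_)
open import Function using (_∘_; _↔_; Injective; Inverse)
open import Relation.Binary.PropositionalEquality
  using (_≡_; _≢_; refl; sym; trans; cong; cong₂; subst; subst₂; module ≡-Reasoning)
open import Relation.Nullary using (¬_; yes; no; contradiction)

-- Distance estimates in arbitrary graphs, and the lower bound.

collision : ∀ (f : Fin 4 → ℕ) d → (∀ i → d ≤ suc (f i)) → (∀ i → f i ≤ suc d) →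
            ∃₂ λ i j → i ≢ j × f i ≡ f j
collision f d low high with pigeonhole (n<1+n 3) (λ i → fromℕ< (offset<3 i))
  where
  -- The values `f i` lie among d - 1, d and d + 1. The shift by one keeps the subtraction from
  -- truncating, so it can be cancelled again once two offsets coincide.
  offset<3 : ∀ i → suc (f i) ∸ d < 3
  offset<3 i = s≤s (m≤n+o⇒m∸n≤o _ d (≤-trans (s≤s (high i)) (≤-reflexive (+-comm 2 d))))
... | i , j , i<j , e =
  i , j , Finₚ.<⇒≢ i<j , suc-injective (∸-cancelʳ-≡ (low i) (low j) (fromℕ<-injective _ _ _ _ e))

module _ (G : Graph) where
  open Graph G

  walk-lipschitz : (f : Vertex → ℕ) → (∀ {u v} → Adj u v → f u ≤ suc (f v)) →
                   ∀ {m u v} → Walk Adj m u v → f u ≤ m + f v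
  walk-lipschitz f lip []      = ≤-refl
  walk-lipschitz f lip (a ∷ p) = ≤-trans (lip a) (s≤s (walk-lipschitz f lip p))

  dist-lipschitz : ∀ {u v} w → Adj u v → dist G u w ≤ suc (dist G v w)
  dist-lipschitz {u} {v} w a = dist-minimal G u w _ (a ∷ dist-walk G v w)

  -- A function that drops by at most one along each edge and vanishes at `v` bounds the distance to
  -- `v` from below; a walk of that length bounds it from above. The explicit distance formulas for
  -- products, paths and cycles are all obtained this way.
  dist-unique : (f : Vertex → ℕ) → (∀ {u v} → Adj u v → f u ≤ suc (f v)) →
                ∀ {u v} → f v ≡ 0 → Walk Adj (f u) u v → dist G u v ≡ f u
  dist-unique f lip {u} {v} fv≡0 p = ≤-antisym (dist-minimal G u v _ p) (begin
    f u               ≤⟨ walk-lipschitz f lip (dist-walk G u v) ⟩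
    dist G u v + f v  ≡⟨ cong (dist G u v +_) fv≡0 ⟩
    dist G u v + 0    ≡⟨ +-identityʳ _ ⟩
    dist G u v        ∎)
    where open ≤-Reasoning

  dist-refl : ∀ u → dist G u u ≡ 0
  dist-refl u = n≤0⇒n≡0 (dist-minimal G u u 0 [])

  dist-adj : ∀ {u v} → Adj u v → dist G u v ≡ 1
  dist-adj {u} {v} a with dist G u v | dist-walk G u v | dist-minimal G u v 1 (a ∷ [])
  ... | 0 | []  | _       = contradiction a (adj-irr refl)
  ... | 1 | _   | s≤s z≤n = refl

  DegreeAtLeast : ℕ → Vertex → Set
  DegreeAtLeast d u = Σ[ v ∈ (Fin d → Vertex) ] Injective _≡_ _≡_ v × (∀ i → Adj u (v i))

  module _ (deg : ∀ u → DegreeAtLeast 4 u) where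

    -- Four neighbours of `q` are all at distance 1 from `q`, and two of them collide at `r`. The
    -- case `q ≡ r` is allowed, so this also covers fewer than two landmarks.
    two-landmarks-confuse : ∀ q r →
      ∃₂ λ x y → x ≢ y × dist G x q ≡ dist G y q × dist G x r ≡ dist G y r
    two-landmarks-confuse q r =
      let v , v-inj , adj = deg q
          i , j , i≢j , e = collision (λ i → dist G (v i) r) (dist G q r)
            (λ i → dist-lipschitz r (adj i)) (λ i → dist-lipschitz r (adj-sym (adj i)))
          near i = dist-adj (adj-sym (adj i))
      in  v i , v j , i≢j ∘ v-inj , trans (near i) (sym (near j)) , e

    -- The vertex argument serves the empty `Q`, which supplies no vertex of its own.
    3≤resolving : Vertex → ∀ l (Q : Vec Vertex l) → ResolvingSet G Q → 3 ≤ l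
    3≤resolving u 0 [] (_ , res) =
      let x , y , x≢y , _ = two-landmarks-confuse u u
      in  ⊥-elim (res x y x≢y refl)
    3≤resolving _ 1 (q ∷ []) (_ , res) =
      let x , y , x≢y , e , _ = two-landmarks-confuse q q
      in  ⊥-elim (res x y x≢y (cong (_∷ []) e))
    3≤resolving _ 2 (q ∷ r ∷ []) (_ , res) =
      let x , y , x≢y , e , e′ = two-landmarks-confuse q r
      in  ⊥-elim (res x y x≢y (cong₂ (λ a b → a ∷ b ∷ []) e e′))
    3≤resolving _ (suc (suc (suc _))) _ _ = s≤s (s≤s (s≤s z≤n))

-- Distances and degrees in cartesian products.

module _ (G H : Graph) where
  private
    module G = Graph G
    module H = Graph H

  dist-□ : ∀ g h g′ h′ → dist (G □ H) (g , h) (g′ , h′) ≡ dist G g g′ + dist H h h′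
  dist-□ g h g′ h′ = dist-unique (G □ H) f lip
    (cong₂ _+_ (dist-refl G g′) (dist-refl H h′))
    (mapʷ (_, h) (λ a → inj₁ (refl , a)) (dist-walk G g g′)
      ++ʷ mapʷ (g′ ,_) (λ a → inj₂ (refl , a)) (dist-walk H h h′))
    where
    f : G.Vertex × H.Vertex → ℕ
    f (x , y) = dist G x g′ + dist H y h′

    lip : ∀ {u v} → Graph.Adj (G □ H) u v → f u ≤ suc (f v)
    lip {_ , y} (inj₁ (refl , a)) = +-monoˡ-≤ (dist H y h′) (dist-lipschitz G g′ a)
    lip {x , _} (inj₂ (refl , a)) =
      ≤-trans (+-monoʳ-≤ (dist G x g′) (dist-lipschitz H h′ a)) (≤-reflexive (+-suc _ _))

  -- Each factor contributes the moves along its own coordinate. Moves of different kinds cannot end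
  -- at the same vertex, since that would give a loop in `G`.
  □-degree : ∀ {d e} g h → DegreeAtLeast G d g → DegreeAtLeast H e h →
             DegreeAtLeast (G □ H) (d + e) (g , h)
  □-degree {d} {e} g h (v , v-inj , v-adj) (w , w-inj , w-adj) =
    f ∘ Inverse.to split , split-inj ∘ f-inj , f-adj ∘ Inverse.to split
    where
    f : Fin d ⊎ Fin e → G.Vertex × H.Vertex
    f (inj₁ i) = v i , h
    f (inj₂ j) = g , w j

    f-inj : Injective _≡_ _≡_ f
    f-inj {inj₁ i} {inj₁ i′} eq = cong inj₁ (v-inj (cong proj₁ eq))
    f-inj {inj₁ i} {inj₂ j}  eq = contradiction (v-adj i) (G.adj-irr (sym (cong proj₁ eq)))
    f-inj {inj₂ j} {inj₁ i}  eq = contradiction (v-adj i) (G.adj-irr (cong proj₁ eq))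
    f-inj {inj₂ j} {inj₂ j′} eq = cong inj₂ (w-inj (cong proj₂ eq))

    f-adj : ∀ s → Graph.Adj (G □ H) (g , h) (f s)
    f-adj (inj₁ i) = inj₁ (refl , v-adj i)
    f-adj (inj₂ j) = inj₂ (refl , w-adj j)

    split : Fin (d + e) ↔ (Fin d ⊎ Fin e)
    split = +↔⊎

    split-inj : Injective _≡_ _≡_ (Inverse.to split)
    split-inj {i} {j} eq =
      trans (sym (Inverse.strictlyInverseʳ split i))
            (trans (cong (Inverse.from split) eq) (Inverse.strictlyInverseʳ split j))

-- Distances and degrees in paths.

pathAdj-lipschitz : ∀ {n} {i j : Fin n} m → PathAdj i j →
                    ∣ toℕ i - m ∣ ≤ suc ∣ toℕ j - m ∣
pathAdj-lipschitz {i = i} {j} m a = begin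
  ∣ toℕ i - m ∣                      ≤⟨ ∣-∣-triangle (toℕ i) (toℕ j) m ⟩
  ∣ toℕ i - toℕ j ∣ + ∣ toℕ j - m ∣  ≡⟨ cong (_+ ∣ toℕ j - m ∣) (unit a) ⟩
  suc ∣ toℕ j - m ∣                  ∎
  where
  open ≤-Reasoning

  ∣n-1+n∣≡1 : ∀ n → ∣ n - suc n ∣ ≡ 1
  ∣n-1+n∣≡1 zero    = refl
  ∣n-1+n∣≡1 (suc n) = ∣n-1+n∣≡1 n

  unit : PathAdj i j → ∣ toℕ i - toℕ j ∣ ≡ 1
  unit (inj₁ e) rewrite e = ∣n-1+n∣≡1 (toℕ i)
  unit (inj₂ e) rewrite e = trans (∣-∣-comm (suc (toℕ j)) (toℕ j)) (∣n-1+n∣≡1 (toℕ j))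

path-walk : ∀ {n} (i j : Fin n) → Walk PathAdj ∣ toℕ i - toℕ j ∣ i j
path-walk zero    zero    = []
path-walk (suc i) (suc j) = mapʷ suc (Sum.map (cong suc) (cong suc)) (path-walk i j)
path-walk {suc (suc n)} zero (suc j) =
  inj₁ refl ∷ mapʷ suc (Sum.map (cong suc) (cong suc)) (path-walk zero j)
path-walk {suc (suc n)} (suc i) zero =
  subst (λ m → Walk PathAdj m (suc i) zero)
        (trans (cong (_+ 1) (∣-∣-identityʳ (toℕ i))) (+-comm _ 1))
        (mapʷ suc (Sum.map (cong suc) (cong suc)) (path-walk i zero) ++ʷ (inj₂ refl ∷ []))

dist-path : ∀ {n} (i j : Fin n) → dist (path n) i j ≡ ∣ toℕ i - toℕ j ∣
dist-path {n} i j = dist-unique (path n) (λ v → ∣ toℕ v - toℕ j ∣)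
  (pathAdj-lipschitz (toℕ j)) (∣n-n∣≡0 (toℕ j)) (path-walk i j)

path-degree : ∀ {n} → 2 ≤ n → (i : Fin n) → DegreeAtLeast (path n) 1 i
path-degree (s≤s (s≤s _)) i = (λ _ → neighbour i) , (λ { {zero} {zero} _ → refl }) , (λ _ → adj i)
  where
  neighbour : ∀ {n} → Fin (suc (suc n)) → Fin (suc (suc n))
  neighbour zero    = suc zero
  neighbour (suc i) = inject₁ i

  adj : ∀ {n} (i : Fin (suc (suc n))) → PathAdj i (neighbour i)
  adj zero    = inj₁ refl
  adj (suc i) = inj₂ (cong suc (sym (toℕ-inject₁ i)))

-- Degrees in the cycle, and distances to vertex 0.

cycle-degree : ∀ n (3≤n : 3 ≤ n) (i : Fin n) → DegreeAtLeast (cycle n 3≤n) 2 i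
cycle-degree (suc m) (s≤s 2≤m) i = neighbour , inj , adj
  where
  successor : ∃[ j ] CycleAdj i j × (toℕ j ≡ suc (toℕ i) ⊎ (toℕ i ≡ m × toℕ j ≡ 0))
  successor with suc (toℕ i) <? suc m
  ... | yes i<m = fromℕ< i<m , inj₁ (inj₁ (toℕ-fromℕ< i<m)) , inj₁ (toℕ-fromℕ< i<m)
  ... | no  i≮m = zero , inj₂ (inj₁ (cong suc i≡m , refl)) , inj₂ (i≡m , refl)
    where
    i≡m : toℕ i ≡ m
    i≡m = ≤-antisym (s≤s⁻¹ (toℕ<n i)) (s≤s⁻¹ (≮⇒≥ i≮m))

  predecessor : ∀ i → ∃[ j ] CycleAdj i j × (toℕ i ≡ suc (toℕ j) ⊎ (toℕ i ≡ 0 × toℕ j ≡ m))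
  predecessor zero    = fromℕ m , inj₂ (inj₂ (cong suc (toℕ-fromℕ m) , refl)) , inj₂ (refl , toℕ-fromℕ m)
  predecessor (suc i) = inject₁ i , inj₁ (inj₂ e) , inj₁ e
    where
    e : suc (toℕ i) ≡ suc (toℕ (inject₁ i))
    e = cong suc (sym (toℕ-inject₁ i))

  neighbour : Fin 2 → Fin (suc m)
  neighbour zero       = proj₁ successor
  neighbour (suc zero) = proj₁ (predecessor i)

  -- Here a is the index of `i` and b that of a vertex on both sides of it. Wrapping around on one
  -- side forces m = 1 and on both sides m = 0; without wrapping, a = a + 2.
  separate : ∀ {a b} → 2 ≤ m → (b ≡ suc a ⊎ (a ≡ m × b ≡ 0)) → ¬ (a ≡ suc b ⊎ (a ≡ 0 × b ≡ m))
  separate {a} _    (inj₁ e)             (inj₁ e′) = m≢1+n+m a {1} (trans e′ (cong suc e))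
  separate (s≤s ()) (inj₁ refl)          (inj₂ (refl , refl))
  separate (s≤s ()) (inj₂ (refl , refl)) (inj₁ refl)

  distinct : proj₁ successor ≢ proj₁ (predecessor i)
  distinct eq = separate 2≤m (proj₂ (proj₂ successor))
    (subst (λ j → toℕ i ≡ suc (toℕ j) ⊎ (toℕ i ≡ 0 × toℕ j ≡ m)) (sym eq)
           (proj₂ (proj₂ (predecessor i))))

  inj : Injective _≡_ _≡_ neighbour
  inj {zero}     {zero}     _  = refl
  inj {zero}     {suc zero} eq = contradiction eq distinct
  inj {suc zero} {zero}     eq = contradiction (sym eq) distinct
  inj {suc zero} {suc zero} _  = refl

  adj : ∀ j → CycleAdj i (neighbour j)
  adj zero       = proj₁ (proj₂ successor)
  adj (suc zero) = proj₁ (proj₂ (predecessor i))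

module _ (m : ℕ) (3≤n : 3 ≤ suc m) where

  dist-cycle-zero : ∀ i → dist (cycle (suc m) 3≤n) i zero ≡ toℕ i ⊓ (suc m ∸ toℕ i)
  dist-cycle-zero i = dist-unique (cycle (suc m) 3≤n) f lip refl shorter-way
    where
    f : Fin (suc m) → ℕ
    f i = toℕ i ⊓ (suc m ∸ toℕ i)

    n≤1+pred-n : ∀ n → n ≤ suc (pred n)
    n≤1+pred-n zero    = z≤n
    n≤1+pred-n (suc n) = ≤-refl

    n∸i≤1+n∸1+i : ∀ n i → n ∸ i ≤ suc (n ∸ suc i)
    n∸i≤1+n∸1+i n i =
      subst (λ x → n ∸ i ≤ suc x) (pred[m∸n]≡m∸[1+n] n i) (n≤1+pred-n (n ∸ i))

    lip : ∀ {i j} → CycleAdj i j → f i ≤ suc (f j)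
    lip {i} {j} (inj₁ (inj₁ e)) rewrite e =
      ⊓-mono-≤ (m≤n+m (toℕ i) 2) (n∸i≤1+n∸1+i (suc m) (toℕ i))
    lip {i} {j} (inj₁ (inj₂ e)) rewrite e =
      ⊓-mono-≤ {suc (toℕ j)} ≤-refl (≤-trans (∸-monoʳ-≤ (suc m) (n≤1+n (toℕ j))) (n≤1+n _))
    -- Across the closing edge, `f` is at most 1 at the last vertex m and equals 0 at vertex 0.
    lip {i} {j} (inj₂ (inj₁ (e , z))) rewrite z | suc-injective e =
      ≤-trans (m⊓n≤n m _) (≤-reflexive (m+n∸n≡m 1 m))
    lip {i} {j} (inj₂ (inj₂ (e , z))) rewrite z = z≤n

    descending : Walk CycleAdj (toℕ i) i zero
    descending = subst (λ l → Walk CycleAdj l i zero) (∣-∣-identityʳ (toℕ i))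
      (mapʷ (λ v → v) inj₁ (path-walk i zero))

    -- The `+ 1` counts the closing edge, taken after climbing from `i` to the last vertex.
    length-eq : ∣ toℕ i - toℕ (fromℕ m) ∣ + 1 ≡ suc m ∸ toℕ i
    length-eq = begin
      ∣ toℕ i - toℕ (fromℕ m) ∣ + 1  ≡⟨ +-comm _ 1 ⟩
      suc ∣ toℕ i - toℕ (fromℕ m) ∣  ≡⟨ cong (λ x → suc ∣ toℕ i - x ∣) (toℕ-fromℕ m) ⟩
      suc ∣ toℕ i - m ∣              ≡⟨ cong suc (m≤n⇒∣m-n∣≡n∸m i≤m) ⟩
      suc (m ∸ toℕ i)                ≡⟨ +-∸-assoc 1 i≤m ⟨
      suc m ∸ toℕ i                  ∎
      where
      open ≡-Reasoning
      i≤m : toℕ i ≤ m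
      i≤m = s≤s⁻¹ (toℕ<n i)

    ascending : Walk CycleAdj (suc m ∸ toℕ i) i zero
    ascending = subst (λ l → Walk CycleAdj l i zero) length-eq
      (mapʷ (λ v → v) inj₁ (path-walk i (fromℕ m))
        ++ʷ (inj₂ (inj₁ (cong suc (toℕ-fromℕ m) , refl)) ∷ []))

    shorter-way : Walk CycleAdj (f i) i zero
    shorter-way with ⊓-sel (toℕ i) (suc m ∸ toℕ i)
    ... | inj₁ e = subst (λ l → Walk CycleAdj l i zero) (sym e) descending
    ... | inj₂ e = subst (λ l → Walk CycleAdj l i zero) (sym e) ascending

-- The middle vertex, and arithmetic for decoding the landmark distances.

middle : ∀ h → Fin (suc (h + h))
middle h = fromℕ h ↑ˡ h

toℕ-middle : ∀ h → toℕ (middle h) ≡ h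
toℕ-middle h = trans (toℕ-↑ˡ (fromℕ h) h) (toℕ-fromℕ h)

zero≢middle : ∀ h → 3 ≤ suc (h + h) → zero ≢ middle h
zero≢middle zero    (s≤s ())
zero≢middle (suc h) _ ()

m≡n+o⇒m∸n≡o : ∀ {m o} n → m ≡ n + o → m ∸ n ≡ o
m≡n+o⇒m∸n≡o {o = o} n refl = m+n∸m≡n n o

doubling-injective : ∀ {m n} → m + m ≡ n + n → m ≡ n
doubling-injective {m} {n} eq = *-cancelˡ-≡ m n 2 (begin
  2 * m  ≡⟨ cong (m +_) (+-identityʳ m) ⟩
  m + m  ≡⟨ eq ⟩
  n + n  ≡⟨ cong (n +_) (+-identityʳ n) ⟨
  2 * n  ∎)
  where open ≡-Reasoning

-- Adding the hypotheses gives 2A + (B + B′) = 2A′ + (B + B′). On a single arc the sum A + B is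
-- constant, so there the difference A - B determines A.
same-sum : ∀ {A A′ B B′} → A + B ≡ A′ + B′ → A + B′ ≡ A′ + B → A ≡ A′
same-sum {A} {A′} {B} {B′} e e′ = doubling-injective (+-cancelʳ-≡ (B + B′) _ _ (begin
  A + A + (B + B′)      ≡⟨ rearrange A A B B′ ⟩
  A + B + (A + B′)      ≡⟨ cong₂ _+_ e e′ ⟩
  A′ + B′ + (A′ + B)    ≡⟨ rearrange′ A′ B B′ ⟩
  A′ + A′ + (B + B′)    ∎))
  where
  open ≡-Reasoning
  rearrange : ∀ w x y z → w + x + (y + z) ≡ w + y + (x + z)
  rearrange = solve-∀
  rearrange′ : ∀ x y z → x + z + (x + y) ≡ x + x + (y + z)
  rearrange′ = solve-∀

-- Subtracting the equations removes the path position: A - B = A′ - B′. The additive form avoids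
-- truncated subtraction.
eliminate : ∀ A A′ B B′ {p p′} → A + p ≡ A′ + p′ → B + p ≡ B′ + p′ → A + B′ ≡ A′ + B
eliminate A A′ B B′ {p} {p′} e e′ = +-cancelʳ-≡ (p + p′) _ _ (begin
  A + B′ + (p + p′)    ≡⟨ rearrange A B′ p p′ ⟩
  A + p + (B′ + p′)    ≡⟨ cong₂ _+_ e (sym e′) ⟩
  A′ + p′ + (B + p)    ≡⟨ rearrange′ A′ B p p′ ⟩
  A′ + B + (p + p′)    ∎)
  where
  open ≡-Reasoning
  rearrange : ∀ w x y z → w + x + (y + z) ≡ w + y + (x + z)
  rearrange = solve-∀
  rearrange′ : ∀ w x y z → w + z + (x + y) ≡ w + x + (y + z)
  rearrange′ = solve-∀

-- Different layers would force the two sums to differ by one in both directions, hence s = s + 2.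
same-layer : ∀ {s s′} (b b′ : Fin 2) →
  s + ∣ toℕ b - 0 ∣ ≡ s′ + ∣ toℕ b′ - 0 ∣ →
  s + ∣ toℕ b - 1 ∣ ≡ s′ + ∣ toℕ b′ - 1 ∣ → b ≡ b′
same-layer zero       zero       _ _ = refl
same-layer (suc zero) (suc zero) _ _ = refl
same-layer {s} {s′} zero (suc zero) e e′ = contradiction
  (trans (sym (+-identityʳ s)) (trans e (cong (_+ 1) (trans (sym (+-identityʳ s′)) (sym e′)))))
  λ eq → m≢1+n+m s {1} (trans eq (add-twice s))
  where
  add-twice : ∀ s → s + 1 + 1 ≡ suc (suc s)
  add-twice = solve-∀
same-layer (suc zero) zero e e′ = sym (same-layer zero (suc zero) (sym e) (sym e′))

-- The two arcs of the odd cycle.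

module _ (h : ℕ) (3≤n : 3 ≤ suc (h + h)) where
  private
    C : Graph
    C = cycle (suc (h + h)) 3≤n

  -- No minimum appears: both ends of the closing edge, 0 and 2h, are at distance h from the middle,
  -- so crossing that edge brings no gain.
  dist-cycle-middle : ∀ i → dist C i (middle h) ≡ ∣ toℕ i - h ∣
  dist-cycle-middle i = dist-unique C (λ v → ∣ toℕ v - h ∣) lip
    (trans (cong ∣_- h ∣ (toℕ-middle h)) (∣n-n∣≡0 h))
    (subst (λ x → Walk CycleAdj ∣ toℕ i - x ∣ i (middle h)) (toℕ-middle h)
      (mapʷ (λ v → v) inj₁ (path-walk i (middle h))))
    where
    ∣last-h∣≡h : ∣ h + h - h ∣ ≡ h
    ∣last-h∣≡h = trans (m≤n⇒∣n-m∣≡n∸m (m≤m+n h h)) (m+n∸n≡m h h)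

    lip : ∀ {i j : Fin (suc (h + h))} → CycleAdj i j → ∣ toℕ i - h ∣ ≤ suc ∣ toℕ j - h ∣
    lip (inj₁ a) = pathAdj-lipschitz h a
    lip (inj₂ (inj₁ (e , z))) rewrite z | suc-injective e | ∣last-h∣≡h = n≤1+n h
    lip (inj₂ (inj₂ (e , z))) rewrite z | suc-injective e | ∣last-h∣≡h = n≤1+n h

  -- A and B are the distances to 0 and to h; the alternatives are the two arcs.
  Arc : ℕ → ℕ → ℕ → Set
  Arc a A B = (A + B ≡ h × a ≡ A) ⊎ (A + B ≡ suc h × a + A ≡ suc (h + h))

  arc-formulas : ∀ i → i < suc (h + h) → Arc i (i ⊓ (suc (h + h) ∸ i)) ∣ i - h ∣
  arc-formulas i i<n with i ≤? h
  ... | yes i≤h =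
    inj₁ (trans (cong₂ _+_ A≡i (m≤n⇒∣m-n∣≡n∸m i≤h)) (m+[n∸m]≡n i≤h) , sym A≡i)
    where
    i≤n∸i : i ≤ suc (h + h) ∸ i
    i≤n∸i = m+n≤o⇒m≤o∸n i (m≤n⇒m≤1+n (+-mono-≤ i≤h i≤h))

    A≡i : i ⊓ (suc (h + h) ∸ i) ≡ i
    A≡i = m≤n⇒m⊓n≡m i≤n∸i
  ... | no  i≰h with m≤n⇒∃[o]m+o≡n (≰⇒> i≰h) | m≤n⇒∃[o]m+o≡n i<n
  -- Writing i = h + 1 + b and n = i + 1 + c removes subtraction: the distances become A = c + 1 and
  -- B = b + 1.
  ...   | b , 1+h+b≡i | c , 1+i+c≡n =
    inj₂ (trans (cong₂ _+_ A≡1+c B≡1+b) 1+c+1+b≡1+h , trans (cong (i +_) A≡1+c) i+1+c≡n)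
    where
    i+1+c≡n : i + suc c ≡ suc (h + h)
    i+1+c≡n = trans (+-suc i c) 1+i+c≡n

    1+c+1+b≡1+h : suc c + suc b ≡ suc h
    1+c+1+b≡1+h = +-cancelˡ-≡ h _ _ (begin
      h + (suc c + suc b)  ≡⟨ rearrange h b c ⟩
      suc (h + b) + suc c  ≡⟨ cong (_+ suc c) 1+h+b≡i ⟩
      i + suc c            ≡⟨ i+1+c≡n ⟩
      suc (h + h)          ≡⟨ +-suc h h ⟨
      h + suc h            ∎)
      where
      open ≡-Reasoning
      rearrange : ∀ h b c → h + (suc c + suc b) ≡ suc (h + b) + suc c
      rearrange = solve-∀

    n∸i≡1+c : suc (h + h) ∸ i ≡ suc c
    n∸i≡1+c = m≡n+o⇒m∸n≡o i (sym i+1+c≡n)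

    1+c≤i : suc c ≤ i
    1+c≤i = ≤-trans (m+n≤o⇒m≤o (suc c) (≤-reflexive 1+c+1+b≡1+h)) (≰⇒> i≰h)

    A≡1+c : i ⊓ (suc (h + h) ∸ i) ≡ suc c
    A≡1+c = trans (cong (i ⊓_) n∸i≡1+c) (m≥n⇒m⊓n≡n 1+c≤i)

    B≡1+b : ∣ i - h ∣ ≡ suc b
    B≡1+b = trans (m≤n⇒∣n-m∣≡n∸m (<⇒≤ (≰⇒> i≰h)))
                  (m≡n+o⇒m∸n≡o h (trans (sym 1+h+b≡i) (sym (+-suc h b))))

  arc : ∀ i → Arc (toℕ i) (dist C i zero) (dist C i (middle h))
  arc i = subst₂ (Arc (toℕ i)) (sym (dist-cycle-zero (h + h) 3≤n i)) (sym (dist-cycle-middle i))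
    (arc-formulas (toℕ i) (toℕ<n i))

  -- Equal differences on opposite arcs would make 2(A + B′) equal to (A + B) + (A′ + B′) = 2h + 1,
  -- an odd number.
  arcs-differ-in-parity : ∀ {A A′ B B′} → A + B ≡ h → A′ + B′ ≡ suc h → A + B′ ≢ A′ + B
  arcs-differ-in-parity {A} {A′} {B} {B′} s s′ e = even≢odd (A + B′) h (begin
    2 * (A + B′)          ≡⟨ cong (A + B′ +_) (+-identityʳ (A + B′)) ⟩
    A + B′ + (A + B′)     ≡⟨ cong (A + B′ +_) e ⟩
    A + B′ + (A′ + B)     ≡⟨ rearrange A B A′ B′ ⟩
    A + B + (A′ + B′)     ≡⟨ cong₂ _+_ s s′ ⟩
    h + suc h             ≡⟨ +-suc h h ⟩
    suc (h + h)           ≡⟨ cong (λ x → suc (h + x)) (+-identityʳ h) ⟨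
    suc (2 * h)           ∎)
    where
    open ≡-Reasoning
    rearrange : ∀ w x y z → w + z + (y + x) ≡ w + x + (y + z)
    rearrange = solve-∀

  -- On a common arc `same-sum` recovers A, and A fixes the position, as A itself or as n - A.
  -- Opposite arcs are excluded by parity.
  arc-injective : ∀ {a a′ A A′ B B′} → Arc a A B → Arc a′ A′ B′ → A + B′ ≡ A′ + B → a ≡ a′
  arc-injective {A = A} {A′} (inj₁ (s , refl)) (inj₁ (s′ , refl)) e =
    same-sum {A} {A′} (trans s (sym s′)) e
  arc-injective {a} {a′} {A} {A′} (inj₂ (s , t)) (inj₂ (s′ , t′)) e =
    +-cancelʳ-≡ A a a′ (trans t (trans (sym t′) (cong (a′ +_) (sym A≡A′))))
    where
    A≡A′ : A ≡ A′
    A≡A′ = same-sum (trans s (sym s′)) e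
  arc-injective {A = A} {A′} (inj₁ (s , _)) (inj₂ (s′ , _)) e =
    contradiction e (arcs-differ-in-parity {A} {A′} s s′)
  arc-injective {A = A} {A′} (inj₂ (s , _)) (inj₁ (s′ , _)) e =
    contradiction (sym e) (arcs-differ-in-parity {A′} {A} s′ s)

  differences-determine-vertex : ∀ i j →
    dist C i zero + dist C j (middle h) ≡ dist C j zero + dist C i (middle h) → i ≡ j
  differences-determine-vertex i j = toℕ-injective ∘ arc-injective (arc i) (arc j)

  -- The three landmarks resolve the product.

  module _ (k : ℕ) where
    private
      G : Graph
      G = (C □ path (suc k)) □ path 2

    landmarks : Vec (Graph.Vertex G) 3
    landmarks = ((zero , zero) , zero) ∷ ((zero , zero) , suc zero) ∷ ((middle h , zero) , zero) ∷ []

    -- All landmarks sit at the end 0 of the long path, so the distance along it is the position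
    -- itself.
    dist-bottom : ∀ a p b c e →
      dist G ((a , p) , b) ((c , zero) , e) ≡ dist C a c + toℕ p + ∣ toℕ b - toℕ e ∣
    dist-bottom a p b c e = begin
      dist G ((a , p) , b) ((c , zero) , e)
        ≡⟨ dist-□ (C □ path (suc k)) (path 2) (a , p) b (c , zero) e ⟩
      dist (C □ path (suc k)) (a , p) (c , zero) + dist (path 2) b e
        ≡⟨ cong₂ _+_ (dist-□ C (path (suc k)) a p c zero) (dist-path b e) ⟩
      dist C a c + dist (path (suc k)) p zero + ∣ toℕ b - toℕ e ∣
        ≡⟨ cong (λ x → dist C a c + x + ∣ toℕ b - toℕ e ∣)
                (trans (dist-path p zero) (∣-∣-identityʳ (toℕ p))) ⟩
      dist C a c + toℕ p + ∣ toℕ b - toℕ e ∣  ∎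
      where open ≡-Reasoning

    landmarks-injective : ∀ x y → representation G x landmarks ≡ representation G y landmarks → x ≡ y
    landmarks-injective ((a , p) , b) ((a′ , p′) , b′) eq =
      cong₂ _,_ (cong₂ _,_ a≡a′ p≡p′) b≡b′
      where
      bottom : ∀ c e →
        dist G ((a , p) , b) ((c , zero) , e) ≡ dist G ((a′ , p′) , b′) ((c , zero) , e) →
        dist C a c + toℕ p + ∣ toℕ b - toℕ e ∣ ≡ dist C a′ c + toℕ p′ + ∣ toℕ b′ - toℕ e ∣
      bottom c e eq = trans (sym (dist-bottom a p b c e)) (trans eq (dist-bottom a′ p′ b′ c e))

      eqs₁ = ∷-injective eq
      eqs₂ = ∷-injective (proj₂ eqs₁)
      eqs₃ = ∷-injective (proj₂ eqs₂)

      b≡b′ : b ≡ b′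
      b≡b′ = same-layer b b′ (bottom zero zero (proj₁ eqs₁)) (bottom zero (suc zero) (proj₁ eqs₂))

      bottom-layer : ∀ c →
        dist G ((a , p) , b) ((c , zero) , zero) ≡ dist G ((a′ , p′) , b′) ((c , zero) , zero) →
        dist C a c + toℕ p ≡ dist C a′ c + toℕ p′
      -- Once the layers agree, their contribution to both distances cancels.
      bottom-layer c eq = +-cancelʳ-≡ ∣ toℕ b - 0 ∣ _ _
        (trans (bottom c zero eq) (cong (λ z → dist C a′ c + toℕ p′ + ∣ toℕ z - 0 ∣) (sym b≡b′)))

      a≡a′ : a ≡ a′
      a≡a′ = differences-determine-vertex a a′
        (eliminate (dist C a zero) (dist C a′ zero) _ _
          (bottom-layer zero (proj₁ eqs₁)) (bottom-layer (middle h) (proj₁ eqs₃)))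

      p≡p′ : p ≡ p′
      p≡p′ = toℕ-injective (+-cancelˡ-≡ (dist C a zero) _ _
        (trans (bottom-layer zero (proj₁ eqs₁))
               (cong (λ v → dist C v zero + toℕ p′) (sym a≡a′))))

    landmarks-resolve : ResolvingSet G landmarks
    landmarks-resolve = distinct , λ x y x≢y eq → x≢y (landmarks-injective x y eq)
      where
      distinct = ((λ ()) ∷ (zero≢middle h 3≤n ∘ cong (proj₁ ∘ proj₁)) ∷ []) ∷ ((λ ()) ∷ []) ∷ [] ∷ []

-- Parity of n and the conclusion.

even-or-odd : ∀ n → (∃[ h ] n ≡ h * 2) ⊎ (∃[ h ] n ≡ suc (h + h))
even-or-odd zero = inj₁ (0 , refl)
even-or-odd (suc n) with even-or-odd n
... | inj₁ (h , refl) = inj₂ (h , cong suc (doubling h))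
  where
  doubling : ∀ h → h * 2 ≡ h + h
  doubling = solve-∀
... | inj₂ (h , refl) = inj₁ (suc h , doubling h)
  where
  doubling : ∀ h → suc (suc (h + h)) ≡ suc h * 2
  doubling = solve-∀

theorem3p2 : (n k : ℕ) (3≤n : 3 ≤ n) → ¬ (2 ∣ n) → 3 ≤ k →
    HasMetricDimension ((cycle n 3≤n □ path k) □ path 2) 3
theorem3p2 n k 3≤n odd 3≤k with even-or-odd n
... | inj₁ (h , e) = contradiction (divides h e) odd
theorem3p2 _ (suc k) 3≤n odd 3≤k | inj₂ (h , refl) =
  (landmarks h 3≤n k , landmarks-resolve h 3≤n k) ,
  3≤resolving G degree ((zero , zero) , zero)
  where
  C G : Graph
  C = cycle (suc (h + h)) 3≤n
  G = (C □ path (suc k)) □ path 2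

  -- Two neighbours along the cycle and one along each path: (2 + 1) + 1 = 4.
  degree : ∀ u → DegreeAtLeast G 4 u
  degree ((a , p) , b) =
    □-degree (C □ path (suc k)) (path 2) (a , p) b
      (□-degree C (path (suc k)) a p (cycle-degree _ 3≤n a) (path-degree (<⇒≤ 3≤k) p))
      (path-degree ≤-refl b)
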